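{- The ideal $\mathcal L$ on $\omega$ generated by lacunary sets is not $\le_K$-homogeneous (in particular, it is not homogeneous).
   Context: An ideal on a set $X$ is a family of subsets of $X$ closed under finite unions and subsets, containing all finite subsets of $X$ and not containing $X$; $\mathcal I^+=\mathcal P(X)\setminus\mathcal I$. A set $A\subseteq\omega$ is lacunary if $\lim_{n}(a_{n+1}-a_n)=\infty$, where $(a_n)$ is the increasing enumeration of $A$; $\mathcal L$ consists of all subsets of finite unions of lacunary sets (and finite sets). For ideals $\mathcal I$ on $X$ and $\mathcal K$ on $Y$, $\mathcal I\le_K\mathcal K$ (Katětov order) means that there is $f:Y\to X$ with $f^{ -1}[B]\in\mathcal K$ for all $B\in\mathcal I$; $\mathcal I$ and $\mathcal K$ are isomorphic if there is a bijection $f:Y\to X$ with $f^{ -1}[B]\in\mathcal K\iff B\in\mathcal I$. For $A\in\mathcal I^+$, $\mathcal I\restriction A=\{B\cap A:B\in\mathcal I\}$ (an ideal on $A$). $\mathcal I$ is homogeneous if $\mathcal I\restriction A$ is isomorphic to $\mathcal I$ for each $A\in\mathcal I^+$, and $\le_K$-homogeneous if $\mathcal I\restriction A\le_K\mathcal I$ and $\mathcal I\le_K\mathcal I\restriction A$ for each $A\in\mathcal I^+$. -}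

module Defs where

open import Level using (0ℓ) renaming (suc to lsuc)
open import Data.Empty using (⊥-elim)
open import Data.Fin.Base using (Fin; zero; suc; toℕ)
open import Data.Fin.Properties using (pigeonhole; toℕ<n)
  renaming (suc-injective to Fin-suc-injective)
open import Data.Irrelevant using ([_])
open import Data.List.Base using (List; []; _∷_; _++_; foldr; length; map)
open import Data.List.Membership.Propositional using (_∈_)
open import Data.List.Membership.Propositional.Properties using (∈-map⁺)
open import Data.List.Relation.Unary.All using (All; []; _∷_)
open import Data.List.Relation.Unary.All.Properties using (++⁺)
open import Data.List.Relation.Unary.Any using (here; there)
open import Data.Nat.Base using (ℕ; zero; suc; _+_; _∸_; _≤_; _<_; _⊔_; s≤s)
open import Data.Nat.Properties
open import Data.Product using (Σ-syntax; ∃-syntax; _×_; _,_)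
open import Data.Refinement using (Refinement; value)
open import Data.Refinement.Properties using (value-injective)
open import Data.Sum using (_⊎_; inj₁; inj₂)
open import Data.Unit using (tt)
open import Function.Base using (_∘_)
open import Function.Bundles using (_⤖_; _⇔_; module Bijection)
open import Relation.Binary.PropositionalEquality using (_≡_; refl; subst)
open import Relation.Nullary using (¬_)
open import Relation.Unary using (Pred; U; ∅; _∪_; _⊆_; _≐_)

-- Arbitrary subsets of X are predicates Pred X 0ℓ; no decidability is
-- assumed.  The empty union needs no separate clause: the empty set is
-- finite.

record Ideal (X : Set) : Set₂ where
  field
    family : Pred (Pred X 0ℓ) (lsuc 0ℓ)
    down   : ∀ {B C} → C ⊆ B → family B → family C
    union  : ∀ {B C} → family B → family C → family (B ∪ C)
    finite : ∀ (xs : List X) → family (_∈ xs)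
    proper : ¬ family U

open Ideal public

infix 4 _∈ᴵ_ _∈⁺_

_∈ᴵ_ : ∀ {X} → Pred X 0ℓ → Ideal X → Set₁
B ∈ᴵ I = family I B

_∈⁺_ : ∀ {X} → Pred X 0ℓ → Ideal X → Set₁
A ∈⁺ I = ¬ (A ∈ᴵ I)

-- A subset regarded as a set in its own right.  Membership proofs are
-- irrelevant, so two elements are equal as soon as their values are.

⟪_⟫ : {X : Set} → Pred X 0ℓ → Set
⟪_⟫ {X} A = Refinement X A

-- B ∩ A, regarded as a subset of A.

trace : {X : Set} (A : Pred X 0ℓ) → Pred X 0ℓ → Pred ⟪ A ⟫ 0ℓ
trace A B = B ∘ value

module _ {X : Set} (I : Ideal X) (A : Pred X 0ℓ) where

  restrictFamily : Pred (Pred ⟪ A ⟫ 0ℓ) (lsuc 0ℓ)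
  restrictFamily C = ∃[ B ] B ∈ᴵ I × C ≐ trace A B

  private
    image : Pred ⟪ A ⟫ 0ℓ → Pred X 0ℓ
    image C x = ∃[ c ] value c ≡ x × C c

    viaImage : ∀ C → image C ∈ᴵ I → restrictFamily C
    viaImage C C∈I = image C , C∈I , (λ {c} Cc → c , refl , Cc) ,
      λ { (c , eq , Cc) → subst C (value-injective eq) Cc }

  restrict : A ∈⁺ I → Ideal ⟪ A ⟫
  restrict A∈⁺ = record
    { family = restrictFamily
    ; down   = λ { {C = C} C⊆ (B , B∈I , ⊆B , _) →
                   viaImage C (down I (λ { (c , refl , Cc) → ⊆B (C⊆ Cc) }) B∈I) }
    ; union  = λ { (B , B∈I , ⊆B , B⊆) (B′ , B′∈I , ⊆B′ , B′⊆) →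
                   B ∪ B′ , union I B∈I B′∈I ,
                   (λ { (inj₁ p) → inj₁ (⊆B p) ; (inj₂ p) → inj₂ (⊆B′ p) }) ,
                   (λ { (inj₁ p) → inj₁ (B⊆ p) ; (inj₂ p) → inj₂ (B′⊆ p) }) }
    ; finite = λ xs → viaImage (_∈ xs)
                 (down I (λ { (c , refl , c∈xs) → ∈-map⁺ value c∈xs })
                         (finite I (map value xs)))
    ; proper = λ { (B , B∈I , ⊆B , _) →
                   A∈⁺ (down I (λ {x} Ax → ⊆B {record { value = x ; proof = [ Ax ] }} tt) B∈I) }
    }

infix 4 _≤K_ _≅_

_≤K_ : {X Y : Set} → Ideal X → Ideal Y → Set₁
_≤K_ {X} {Y} I K = Σ[ f ∈ (Y → X) ] ∀ B → B ∈ᴵ I → (B ∘ f) ∈ᴵ K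

_≅_ : {X Y : Set} → Ideal X → Ideal Y → Set₁
_≅_ {X} {Y} I K =
  Σ[ f ∈ Y ⤖ X ] ∀ B → ((B ∘ Bijection.to f) ∈ᴵ K) ⇔ (B ∈ᴵ I)

Homogeneous : {X : Set} → Ideal X → Set₁
Homogeneous I = ∀ A (A∈⁺ : A ∈⁺ I) → restrict I A A∈⁺ ≅ I

≤K-Homogeneous : {X : Set} → Ideal X → Set₁
≤K-Homogeneous I =
  ∀ A (A∈⁺ : A ∈⁺ I) → (restrict I A A∈⁺ ≤K I) × (I ≤K restrict I A A∈⁺)

IncreasingEnumeration : Pred ℕ 0ℓ → (ℕ → ℕ) → Set
IncreasingEnumeration A a =
  (∀ n → a n < a (suc n)) × A ≐ (λ x → ∃[ n ] a n ≡ x)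

TendsToInfinity : (ℕ → ℕ) → Set
TendsToInfinity s = ∀ d → ∃[ N ] ∀ n → N ≤ n → d ≤ s n

-- The truncated subtraction is exact, since a is increasing.

Lacunary : Pred ℕ 0ℓ → Set
Lacunary A =
  ∃[ a ] IncreasingEnumeration A a × TendsToInfinity (λ n → a (suc n) ∸ a n)

Finite : Pred ℕ 0ℓ → Set
Finite A = ∃[ xs ] A ≐ (_∈ xs)

⋃ˡ : List (Pred ℕ 0ℓ) → Pred ℕ 0ℓ
⋃ˡ = foldr _∪_ ∅

𝓛-family : Pred (Pred ℕ 0ℓ) (lsuc 0ℓ)
𝓛-family C = ∃[ Fs ] All (λ F → Lacunary F ⊎ Finite F) Fs × C ⊆ ⋃ˡ Fs

private
  ⋃-++ˡ : ∀ Fs Gs → ⋃ˡ Fs ⊆ ⋃ˡ (Fs ++ Gs)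
  ⋃-++ˡ (F ∷ Fs) Gs (inj₁ p) = inj₁ p
  ⋃-++ˡ (F ∷ Fs) Gs (inj₂ p) = inj₂ (⋃-++ˡ Fs Gs p)

  ⋃-++ʳ : ∀ Fs Gs → ⋃ˡ Gs ⊆ ⋃ˡ (Fs ++ Gs)
  ⋃-++ʳ []       Gs p = p
  ⋃-++ʳ (F ∷ Fs) Gs p = inj₂ (⋃-++ʳ Fs Gs p)

-- Beyond N, distinct elements of F are at distance at least d.

Sparse : ℕ → ℕ → Pred ℕ 0ℓ → Set
Sparse d N F = ∀ {x y} → F x → F y → N ≤ x → x < y → x + d ≤ y

module _ {a : ℕ → ℕ} (a↑ : ∀ n → a n < a (suc n)) where

  enum-mono-≤ : ∀ {i j} → i ≤ j → a i ≤ a j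
  enum-mono-≤ {i} {zero}  i≤0 rewrite n≤0⇒n≡0 i≤0 = ≤-refl
  enum-mono-≤ {i} {suc j} i≤1+j with m≤n⇒m<n∨m≡n i≤1+j
  ... | inj₁ (s≤s i≤j) = ≤-trans (enum-mono-≤ i≤j) (<⇒≤ (a↑ j))
  ... | inj₂ refl      = ≤-refl

  enum-cancel-< : ∀ {i j} → a i < a j → i < j
  enum-cancel-< aᵢ<aⱼ = ≰⇒> (λ j≤i → <⇒≱ aᵢ<aⱼ (enum-mono-≤ j≤i))

lacunary⇒sparse : ∀ {F} → Lacunary F → ∀ d → ∃[ N ] Sparse d N F
lacunary⇒sparse (a , (a↑ , F⊆ , _) , lim) d with lim d
... | N , far = a N , λ Fx Fy → go (F⊆ Fx) (F⊆ Fy)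
  where
  open ≤-Reasoning
  go : ∀ {x y} → ∃[ i ] a i ≡ x → ∃[ j ] a j ≡ y → a N ≤ x → x < y → x + d ≤ y
  go (i , refl) (j , refl) aN≤ai ai<aj = begin
    a i + d                   ≤⟨ +-monoʳ-≤ (a i) (far i N≤i) ⟩
    a i + (a (suc i) ∸ a i)   ≡⟨ m+[n∸m]≡n (<⇒≤ (a↑ i)) ⟩
    a (suc i)                 ≤⟨ enum-mono-≤ a↑ (enum-cancel-< a↑ ai<aj) ⟩
    a j                       ∎
    where
    N≤i : N ≤ i
    N≤i = ≮⇒≥ (λ i<N → <⇒≱ (≤-trans (a↑ i) (enum-mono-≤ a↑ i<N)) aN≤ai)

bound : (xs : List ℕ) → ∃[ N ] ∀ {x} → x ∈ xs → x < N
bound []       = 0 , λ ()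
bound (x ∷ xs) with bound xs
... | N , below = suc x ⊔ N , λ
  { (here refl) → m≤m⊔n (suc x) N
  ; (there p)   → ≤-trans (below p) (m≤n⊔m (suc x) N) }

finite⇒sparse : ∀ {F} → Finite F → ∀ d → ∃[ N ] Sparse d N F
finite⇒sparse (xs , F⊆ , _) d with bound xs
... | N , below = N , λ Fx _ N≤x _ → ⊥-elim (<⇒≱ (below (F⊆ Fx)) N≤x)

allSparse : ∀ {Fs} → All (λ F → Lacunary F ⊎ Finite F) Fs → ∀ d →
            ∃[ N ] All (Sparse d N) Fs
allSparse []       d = 0 , []
allSparse (p ∷ ps) d with one p | allSparse ps d
  where
  one : ∀ {F} → Lacunary F ⊎ Finite F → ∃[ N ] Sparse d N F
  one (inj₁ lac) = lacunary⇒sparse lac d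
  one (inj₂ fin) = finite⇒sparse fin d
... | N , s | M , ss =
  N ⊔ M , (λ Fx Fy ≤x → s Fx Fy (≤-trans (m≤m⊔n N M) ≤x)) ∷
          weaken ss
  where
  weaken : ∀ {Gs} → All (Sparse d M) Gs → All (Sparse d (N ⊔ M)) Gs
  weaken []       = []
  weaken (t ∷ ts) = (λ Fx Fy ≤x → t Fx Fy (≤-trans (m≤n⊔m N M) ≤x)) ∷ weaken ts

private
  index : ∀ Fs {x} → ⋃ˡ Fs x → Fin (length Fs)
  index (F ∷ Fs) (inj₁ _) = zero
  index (F ∷ Fs) (inj₂ p) = suc (index Fs p)

  apart : ∀ {d N Fs} → All (Sparse d N) Fs → ∀ {x y}
          (p : ⋃ˡ Fs x) (q : ⋃ˡ Fs y) → index Fs p ≡ index Fs q →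
          N ≤ x → x < y → x + d ≤ y
  apart (s ∷ ss) (inj₁ p) (inj₁ q) _  = s p q
  apart (s ∷ ss) (inj₂ p) (inj₂ q) eq = apart ss p q (Fin-suc-injective eq)

-- A member of 𝓛 contains no long runs of consecutive numbers far out.

𝓛-noRuns : ∀ {C} → 𝓛-family C →
           ∃[ k ] ∃[ N ] ∀ n → N ≤ n → ¬ (∀ i → i < k → C (n + i))
𝓛-noRuns {C} (Fs , ps , C⊆) with allSparse ps (suc (length Fs))
... | N , ss = suc (length Fs) , N , contra
  where
  contra : ∀ n → N ≤ n → ¬ (∀ i → i < suc (length Fs) → C (n + i))
  contra n N≤n run
    with i , j , i<j , eq ← pigeonhole (n<1+n (length Fs))
           (λ i → index Fs (C⊆ (run (toℕ i) (toℕ<n i))))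
    = <⇒≱ (begin-strict
        n + toℕ j                         <⟨ +-monoʳ-< n (toℕ<n j) ⟩
        n + suc (length Fs)               ≤⟨ +-monoˡ-≤ _ (m≤m+n n (toℕ i)) ⟩
        n + toℕ i + suc (length Fs)       ∎)
      (apart ss (C⊆ (run (toℕ i) (toℕ<n i))) (C⊆ (run (toℕ j) (toℕ<n j))) eq
        (≤-trans N≤n (m≤m+n n (toℕ i))) (+-monoʳ-< n i<j))
    where open ≤-Reasoning

𝓛 : Ideal ℕ
𝓛 = record
  { family = 𝓛-family
  ; down   = λ { C⊆B (Fs , ps , B⊆) → Fs , ps , λ Cx → B⊆ (C⊆B Cx) }
  ; union  = λ { (Fs , ps , B⊆) (Gs , qs , C⊆) → Fs ++ Gs , ++⁺ ps qs , λ
                 { (inj₁ p) → ⋃-++ˡ Fs Gs (B⊆ p) ; (inj₂ p) → ⋃-++ʳ Fs Gs (C⊆ p) } }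
  ; finite = λ xs → (_∈ xs) ∷ [] , inj₂ (xs , (λ p → p) , λ p → p) ∷ [] , inj₁
  ; proper = λ m → let (k , N , noRun) = 𝓛-noRuns m in noRun N ≤-refl (λ _ _ → tt)
  }

{-# OPTIONS --safe #-}
module Submission where

-- The witness is a set A, called Clusters below, for which 𝓛 restricted to
-- A is not Katětov below 𝓛.  It is a union of finite blocks with gaps
-- between successive blocks tending to infinity.  Block n has a level
-- ℓ = level n and consists of ℓ + 1 points with common difference ℓ; every
-- level is taken infinitely often.  Since windows of bounded length far
-- out contain arbitrarily many points of A, A is not in 𝓛 (Clusters∉𝓛).
--
-- Write Low K for the points of A of level below K.
--
--  * Low K is in 𝓛 (low∈𝓛): its blocks have at most K points each, and the
--    i-th points of all blocks form a lacunary set.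
--  * A subset of A that has only finitely many points in each Low K has
--    gaps tending to infinity, hence is in 𝓛 (sparse⇒𝓛, for decidable sets).
--
-- So A is an increasing union of members of 𝓛 such that every subset of A
-- meeting each of them in a finite set is again in 𝓛.  Such a decomposition
-- cannot be pulled back to ω.  Let f : ω → A pull members of 𝓛 back to
-- members of 𝓛.  The preimage of Low K is in 𝓛, so its complement contains
-- a run of K consecutive numbers beyond K (𝓛-gap).  Let Runs be the f-image
-- of the union of these runs, one for each K.  Only the runs with K < d can
-- contribute points to Low d, so Runs is in 𝓛; but its preimage contains
-- arbitrarily long runs arbitrarily far out, and so is not in 𝓛.
--
-- All sets to be searched are decidable, which makes the choice of runs and
-- the enumeration of Runs constructive.

open import Level using (0ℓ)
open import Data.Empty using (⊥-elim)
open import Data.Fin.Base as Fin using (Fin; toℕ)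
open import Data.Fin.Properties using (pigeonhole; toℕ<n; toℕ≤pred[n]; ¬∀⟶∃¬)
open import Data.Irrelevant using ([_])
open import Data.List.Base using ([]; _∷_; length; lookup; applyUpTo)
open import Data.List.Membership.Propositional.Properties using (∈-lookup; ∈-applyUpTo⁺)
open import Data.List.Relation.Unary.All as All using (All; []; _∷_)
open import Data.Nat.Base
open import Data.Nat.Properties
open import Data.Product using (∃-syntax; _×_; _,_; proj₁; proj₂)
open import Data.Refinement using (value)
open import Data.Sum using (_⊎_; inj₁; inj₂)
open import Function.Base using (_∘_; id)
open import Function.Bundles using (module Bijection; module Equivalence)
open import Relation.Binary.Definitions using (tri<; tri≈; tri>)
open import Relation.Binary.PropositionalEquality
open import Relation.Nullary using (¬_; yes; no; _×-dec_)
open import Relation.Nullary.Decidable using (map′; recompute)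
open import Relation.Unary using (Pred; Decidable; _∪_; _⊆_)
open import Defs

-- Increasing sequences and bounds

n≤enum : ∀ {a : ℕ → ℕ} → (∀ n → a n < a (suc n)) → ∀ n → n ≤ a n
n≤enum a↑ zero    = z≤n
n≤enum a↑ (suc n) = ≤-trans (s≤s (n≤enum a↑ n)) (a↑ n)

bound-< : ∀ (h : ℕ → ℕ) n → ∃[ N ] ∀ {i} → i < n → h i < N
bound-< h n = let N , below = bound (applyUpTo h n) in N , below ∘ ∈-applyUpTo⁺ h

-- Members of 𝓛 have bounded density

⋃-member : ∀ Fs {x} → ⋃ˡ Fs x → ∃[ i ] lookup Fs i x
⋃-member (F ∷ Fs) (inj₁ p) = Fin.zero , p
⋃-member (F ∷ Fs) (inj₂ p) = let i , q = ⋃-member Fs p in Fin.suc i , q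

-- Every window [w, w + d) with N ≤ w contains at most m elements of C,
-- stated as: no increasing family of m + 1 elements of C lies in it.
Uncrowded : Pred ℕ 0ℓ → ℕ → ℕ → ℕ → Set
Uncrowded C m d N = ∀ w → N ≤ w → (g : Fin (suc m) → ℕ) →
  (∀ {i j} → i Fin.< j → g i < g j) →
  (∀ i → w ≤ g i) → (∀ i → g i < w + d) → ¬ (∀ i → C (g i))

-- The bound m, a number of lacunary or finite sets covering C, does not
-- depend on the window length: two elements of the same covering set are
-- eventually at least d apart.
𝓛-uncrowded : ∀ {C} → C ∈ᴵ 𝓛 → ∃[ m ] ∀ d → ∃[ N ] Uncrowded C m d N
𝓛-uncrowded {C} (Fs , ps , C⊆) = length Fs , λ d →
  let N , sparse = allSparse ps d in N , uncrowded d N sparse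
  where
  uncrowded : ∀ d N → All (Sparse d N) Fs → Uncrowded C (length Fs) d N
  uncrowded d N sparse w N≤w g g↑ w≤g g<w+d g∈C
    with i , j , i<j , eq ← pigeonhole (n<1+n (length Fs)) (λ i → proj₁ (⋃-member Fs (C⊆ (g∈C i))))
    = let k , gi∈ = ⋃-member Fs (C⊆ (g∈C i))
          l , gj∈ = ⋃-member Fs (C⊆ (g∈C j))
      in <⇒≱ (g<w+d j) (≤-trans (+-monoˡ-≤ d (w≤g i))
           (All.lookup sparse (∈-lookup {xs = Fs} k)
             gi∈ (subst (λ k → lookup Fs k (g j)) (sym eq) gj∈)
             (≤-trans N≤w (w≤g i)) (g↑ i<j)))

-- Decidable sets with gaps tending to infinity are in 𝓛

-- Such a set F is covered by the range of a single lacunary sequence, walk,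
-- which follows F as long as the next element of F is near, and otherwise
-- inserts a filler far from the elements of F on both sides.  Fillers make
-- the sequence infinite even if F is finite.

module _ {F : Pred ℕ 0ℓ} (F? : Decidable F) where

  -- Either the next element of F after a, or the absence of elements of F
  -- in (a, a + b].
  NextOrFar : ℕ → ℕ → Set
  NextOrFar a b = (∃[ y ] a < y × F y × (∀ {z} → a < z → z < y → ¬ F z))
                ⊎ (∀ {z} → a < z → z ≤ a + b → ¬ F z)

  search : ∀ a b → NextOrFar a b
  search a zero = inj₂ λ a<z z≤a+0 _ → <⇒≱ a<z (≤-trans z≤a+0 (≤-reflexive (+-identityʳ a)))
  search a (suc b) with search a b
  ... | inj₁ found = inj₁ found
  ... | inj₂ none with F? (a + suc b)
  ...   | yes Fy = inj₁ (a + suc b , m<m+n a z<s , Fy , λ a<z z<y →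
                     none a<z (s≤s⁻¹ (≤-trans z<y (≤-reflexive (+-suc a b)))))
  ...   | no ¬Fy = inj₂ λ a<z z≤y → case a<z (m≤n⇒m<n∨m≡n z≤y)
    where
    case : ∀ {z} → a < z → z < a + suc b ⊎ z ≡ a + suc b → ¬ F z
    case a<z (inj₁ z<y)  = none a<z (s≤s⁻¹ (≤-trans z<y (≤-reflexive (+-suc a b))))
    case a<z (inj₂ refl) = ¬Fy

  -- If the window is empty, its midpoint is the filler.
  choose : ∀ n a → NextOrFar a (suc n + suc n) → ℕ
  choose n a (inj₁ (y , _)) = y
  choose n a (inj₂ _)       = a + suc n

  walk : ℕ → ℕ
  walk zero    = 0
  walk (suc n) = choose n (walk n) (search (walk n) (suc n + suc n))

  -- The term after walk n is a filler: it is suc n above walk n, and more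
  -- than suc n below the next element of F.
  Filler : ℕ → Set
  Filler n = walk (suc n) ≡ walk n + suc n
           × (∀ {z} → walk n < z → F z → walk n + suc n + suc n < z)

  walk-step : ∀ n → F (walk (suc n)) ⊎ Filler n
  walk-step n with search (walk n) (suc n + suc n)
  ... | inj₁ (_ , _ , Fy , _) = inj₁ Fy
  ... | inj₂ none = inj₂ (refl , λ a<z Fz → ≰⇒> λ z≤ →
          none a<z (≤-trans z≤ (≤-reflexive (+-assoc (walk n) _ _))) Fz)

  walk↑ : ∀ n → walk n < walk (suc n)
  walk↑ n with search (walk n) (suc n + suc n)
  ... | inj₁ (_ , a<y , _) = a<y
  ... | inj₂ _             = m<m+n (walk n) z<s

  walk-skips : ∀ n {z} → walk n < z → z < walk (suc n) → ¬ F z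
  walk-skips n a<z z<b with search (walk n) (suc n + suc n)
  ... | inj₁ (_ , _ , _ , none) = none a<z z<b
  ... | inj₂ none = none a<z (≤-trans (<⇒≤ z<b) (+-monoʳ-≤ (walk n) (m≤m+n (suc n) (suc n))))

  walk-covers : ∀ {x} → F x → ∃[ n ] walk n ≡ x
  walk-covers {x} Fx = go x (n≤enum walk↑ x)
    where
    go : ∀ n → x ≤ walk n → ∃[ n ] walk n ≡ x
    go zero    x≤0 = 0 , sym (n≤0⇒n≡0 x≤0)
    go (suc n) x≤w with m≤n⇒m<n∨m≡n x≤w
    ... | inj₂ eq  = suc n , sym eq
    ... | inj₁ x<w with x ≤? walk n
    ...   | yes x≤wn = go n x≤wn
    ...   | no  x≰wn = ⊥-elim (walk-skips n (≰⇒> x≰wn) x<w Fx)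

  module _ (sparse : ∀ d → ∃[ N ] Sparse d N F) where

    -- A gap between two elements of F is long by sparseness; a gap next to
    -- a filler is long because the search windows grow.
    walk-gaps : TendsToInfinity (λ n → walk (suc n) ∸ walk n)
    walk-gaps d with sparse d
    ... | N , apart = suc (N + d) , λ { (suc n) (s≤s N+d≤n) → m+n≤o⇒n≤o∸m (walk (suc n)) (gap n N+d≤n) }
      where
      m+n≤o⇒n≤o∸m : ∀ m {n o} → m + n ≤ o → n ≤ o ∸ m
      m+n≤o⇒n≤o∸m m {n} le = m+n≤o⇒m≤o∸n n (≤-trans (≤-reflexive (+-comm n m)) le)

      gap : ∀ n → N + d ≤ n → walk (suc n) + d ≤ walk (suc (suc n))
      gap n N+d≤n with walk-step (suc n) | walk-step n
      ... | inj₂ (eq , _) | _ = ≤-trans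
              (+-monoʳ-≤ (walk (suc n)) (≤-trans (m+n≤o⇒n≤o N N+d≤n) (m≤n+m n 2)))
              (≤-reflexive (sym eq))
      ... | inj₁ Fy | inj₁ Fx = apart Fx Fy
              (≤-trans (m+n≤o⇒m≤o N N+d≤n) (≤-trans (n≤1+n n) (n≤enum walk↑ (suc n))))
              (walk↑ (suc n))
      ... | inj₁ Fy | inj₂ (eq , far) = begin
              walk (suc n) + d            ≡⟨ cong (_+ d) eq ⟩
              walk n + suc n + d          ≤⟨ +-monoʳ-≤ (walk n + suc n) (m≤n⇒m≤1+n (m+n≤o⇒n≤o N N+d≤n)) ⟩
              walk n + suc n + suc n      ≤⟨ <⇒≤ (far (<-trans (walk↑ n) (walk↑ (suc n))) Fy) ⟩
              walk (suc (suc n))          ∎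
        where open ≤-Reasoning

    sparse⇒𝓛 : F ∈ᴵ 𝓛
    sparse⇒𝓛 = (λ x → ∃[ n ] walk n ≡ x) ∷ [] ,
               inj₁ (walk , (walk↑ , id , id) , walk-gaps) ∷ [] ,
               inj₁ ∘ walk-covers

-- A sequence of levels

-- The pairs (k , m) in the order (0 , 0), (1 , 1), (0 , 1), (2 , 2), (1 , 2),
-- (0 , 2), (3 , 3), ...: the first component counts down from m to 0, then
-- m is increased and the countdown restarts.
countdown : ℕ → ℕ × ℕ
countdown zero    = 0 , 0
countdown (suc n) with countdown n
... | zero  , m = suc m , suc m
... | suc k , m = k , m

-- The level of the n-th block: 0, 1, 0, 2, 1, 0, 3, ...
level : ℕ → ℕ
level n = proj₁ (countdown n)

countdown-≤ : ∀ n → level n ≤ proj₂ (countdown n) × proj₂ (countdown n) ≤ n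
countdown-≤ zero = z≤n , z≤n
countdown-≤ (suc n) with countdown n | countdown-≤ n
... | zero  , m | _     , m≤n = ≤-refl , s≤s m≤n
... | suc k , m | 1+k≤m , m≤n = <⇒≤ 1+k≤m , m≤n⇒m≤1+n m≤n

level≤ : ∀ n → level n ≤ n
level≤ n = ≤-trans (proj₁ (countdown-≤ n)) (proj₂ (countdown-≤ n))

countdown-restart : ∀ n {m} → countdown n ≡ (0 , m) → countdown (suc n) ≡ (suc m , suc m)
countdown-restart n eq rewrite eq = refl

countdown-descend : ∀ j {n k m} → countdown n ≡ (j + k , m) → countdown (j + n) ≡ (k , m)
countdown-descend zero    eq = eq
countdown-descend (suc j) {n} {k} {m} eq
  rewrite countdown-descend j {n} {suc k} {m} (trans eq (cong (_, m) (sym (+-suc j k)))) = refl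

countdown-zero : ∀ K N → ∃[ n ] ∃[ m ] N ≤ n × K ≤ m × countdown n ≡ (0 , m)
countdown-zero zero N = level N + N , proj₂ (countdown N) , m≤n+m N (level N) , z≤n ,
  countdown-descend (level N) (cong (_, proj₂ (countdown N)) (sym (+-identityʳ (level N))))
countdown-zero (suc K) N with n , m , N≤n , K≤m , eq ← countdown-zero K N =
  suc m + suc n , suc m , ≤-trans N≤n (≤-trans (n≤1+n n) (m≤n+m (suc n) (suc m))) , s≤s K≤m ,
  countdown-descend (suc m) (trans (countdown-restart n eq) (cong (_, suc m) (sym (+-identityʳ (suc m)))))

level-recurs : ∀ k N → ∃[ n ] N ≤ n × level n ≡ k
level-recurs k N with n , m , N≤n , k≤m , eq ← countdown-zero k N =
  (suc m ∸ k) + suc n , ≤-trans N≤n (≤-trans (n≤1+n n) (m≤n+m (suc n) (suc m ∸ k))) ,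
  cong proj₁ (countdown-descend (suc m ∸ k) (trans (countdown-restart n eq)
    (cong (_, suc m) (sym (m∸n+n≡m (m≤n⇒m≤1+n k≤m))))))

-- The set Clusters

-- The least element of the n-th block.  The block ends at
-- base n + level n * level n, which leaves a gap of suc n before the next.
base : ℕ → ℕ
base zero    = 0
base (suc n) = base n + level n * level n + suc n

-- The i-th point of the n-th block, meaningful for i ≤ level n.
point : ℕ → ℕ → ℕ
point n i = base n + i * level n

base↑ : ∀ n → base n < base (suc n)
base↑ n = ≤-<-trans (m≤m+n (base n) _) (m<m+n _ z<s)

point-gap : ∀ {n} i {m} j → i ≤ level n → n < m → point n i + suc n ≤ point m j
point-gap {n} i {m} j i≤ n<m = begin
  point n i + suc n   ≤⟨ +-monoˡ-≤ (suc n) (+-monoʳ-≤ (base n) (*-monoˡ-≤ (level n) i≤)) ⟩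
  base (suc n)        ≤⟨ enum-mono-≤ base↑ n<m ⟩
  base m              ≤⟨ m≤m+n (base m) _ ⟩
  point m j           ∎
  where open ≤-Reasoning

point-cancel-< : ∀ n {i j} → point n i < point n j → i < j
point-cancel-< n {i} {j} lt = ≰⇒> λ j≤i →
  <⇒≱ lt (+-monoʳ-≤ (base n) (*-monoˡ-≤ (level n) j≤i))

-- Membership in the n-th block.
PointOf : ℕ → Pred ℕ 0ℓ
PointOf n x = ∃[ i ] i ≤ level n × point n i ≡ x

pointOf? : ∀ n → Decidable (PointOf n)
pointOf? n x = map′ (λ (i , i< , eq) → i , s≤s⁻¹ i< , eq) (λ (i , i≤ , eq) → i , s≤s i≤ , eq)
  (anyUpTo? (λ i → point n i ≟ x) (suc (level n)))

pointOf⇒≤ : ∀ n {x} → PointOf n x → n ≤ x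
pointOf⇒≤ n (_ , _ , refl) = ≤-trans (n≤enum base↑ n) (m≤m+n (base n) _)

-- Points of one block are at least its level apart, and distinct blocks are
-- further apart than the level n of the lower one, since level n ≤ n.
points-apart : ∀ n m {x y} → PointOf n x → PointOf m y → x < y → x + level n ≤ y
points-apart n m (i , i≤ , refl) (j , j≤ , refl) x<y with <-cmp n m
... | tri< n<m _ _ = ≤-trans (+-monoʳ-≤ (point n i) (m≤n⇒m≤1+n (level≤ n))) (point-gap i j i≤ n<m)
... | tri> _ _ m<n = ⊥-elim (<⇒≱ x<y (m+n≤o⇒m≤o _ (point-gap j i j≤ m<n)))
... | tri≈ _ refl _ = begin
  point n i + level n               ≡⟨ +-assoc (base n) _ _ ⟩
  base n + (i * level n + level n) ≡⟨ cong (base n +_) (+-comm (i * level n) _) ⟩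
  point n (suc i)                   ≤⟨ +-monoʳ-≤ (base n) (*-monoˡ-≤ (level n) (point-cancel-< n {i} {j} x<y)) ⟩
  point n j                         ∎
  where open ≤-Reasoning

-- The union of all blocks.
Clusters : Pred ℕ 0ℓ
Clusters x = ∃[ n ] PointOf n x

-- The union of the blocks of level below K.
Low : ℕ → Pred ℕ 0ℓ
Low K x = ∃[ n ] level n < K × PointOf n x

-- Block n lies at or above n, so only the blocks n ≤ x can contain x.
clusters? : Decidable Clusters
clusters? x = map′ (λ (n , _ , p) → n , p) (λ (n , p) → n , s≤s (pointOf⇒≤ n p) , p)
  (anyUpTo? (λ n → pointOf? n x) (suc x))

low? : ∀ K → Decidable (Low K)
low? K x = map′ (λ (n , _ , p) → n , p) (λ (n , l , p) → n , s≤s (pointOf⇒≤ n p) , l , p)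
  (anyUpTo? (λ n → level n <? K ×-dec pointOf? n x) (suc x))

-- A block of level suc m has more than m points in a window of length
-- suc (m * suc m), and such blocks occur arbitrarily far out.
Clusters∉𝓛 : Clusters ∈⁺ 𝓛
Clusters∉𝓛 C∈𝓛 with m , uncrowded ← 𝓛-uncrowded C∈𝓛
  with N , contra ← uncrowded (suc (m * suc m))
  with n , N≤n , eq ← level-recurs (suc m) N
  = contra (base n) (≤-trans N≤n (n≤enum base↑ n)) (λ i → base n + toℕ i * suc m)
      (λ i<j → +-monoʳ-< (base n) (*-monoˡ-< (suc m) i<j))
      (λ i → m≤m+n (base n) _)
      (λ i → +-monoʳ-< (base n) (s≤s (*-monoˡ-≤ (suc m) (toℕ≤pred[n] i))))
      (λ i → n , toℕ i , ≤-trans (<⇒≤ (toℕ<n i)) (≤-reflexive (sym eq)) ,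
               cong (λ l → base n + toℕ i * l) eq)

-- The blocks of low level form a member of 𝓛

-- The i-th point of the n-th block, or its last point if there is no i-th;
-- the truncation keeps the sequence increasing for every i.
column : ℕ → ℕ → ℕ
column i n = point n (i ⊓ level n)

column-step : ∀ i n → column i n + suc n ≤ column i (suc n)
column-step i n = point-gap (i ⊓ level n) (i ⊓ level (suc n)) (m⊓n≤n i (level n)) ≤-refl

Column : ℕ → Pred ℕ 0ℓ
Column i x = ∃[ n ] column i n ≡ x

column-lacunary : ∀ i → Lacunary (Column i)
column-lacunary i = column i ,
  ((λ n → <-≤-trans (m<m+n (column i n) z<s) (column-step i n)) , id , id) ,
  λ d → d , λ n d≤n → m+n≤o⇒m≤o∸n d (begin
    d + column i n        ≡⟨ +-comm d _ ⟩
    column i n + d        ≤⟨ +-monoʳ-≤ (column i n) (m≤n⇒m≤1+n d≤n) ⟩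
    column i n + suc n    ≤⟨ column-step i n ⟩
    column i (suc n)      ∎)
  where open ≤-Reasoning

columns∈𝓛 : ∀ K → (λ x → ∃[ i ] i < K × Column i x) ∈ᴵ 𝓛
columns∈𝓛 zero    = down 𝓛 (λ ()) (finite 𝓛 [])
columns∈𝓛 (suc K) = down 𝓛 split
  (union 𝓛 (columns∈𝓛 K) (Column K ∷ [] , inj₁ (column-lacunary K) ∷ [] , inj₁))
  where
  split : (λ x → ∃[ i ] i < suc K × Column i x) ⊆ (λ x → ∃[ i ] i < K × Column i x) ∪ Column K
  split (i , i<1+K , p) with m<1+n⇒m<n∨m≡n i<1+K
  ... | inj₁ i<K  = inj₁ (i , i<K , p)
  ... | inj₂ refl = inj₂ p

low∈𝓛 : ∀ K → Low K ∈ᴵ 𝓛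
low∈𝓛 K = down 𝓛 (λ { (n , l<K , i , i≤l , eq) →
    i , ≤-<-trans i≤l l<K , n , trans (cong (point n) (m≤n⇒m⊓n≡m i≤l)) eq })
  (columns∈𝓛 K)

-- Complements of members of 𝓛 contain long runs

module _ {E : Pred ℕ 0ℓ} (E? : Decidable E) (K : ℕ) where

  -- E meets the j-th of the consecutive intervals of length K that start
  -- at w.
  Hit : ℕ → Pred ℕ 0ℓ
  Hit w j = ∃[ i ] i < K × E (w + j * K + i)

  hit? : ∀ w → Decidable (Hit w)
  hit? w j = anyUpTo? (λ i → E? (w + j * K + i)) K

  block-end : ∀ w j {i} → i < K → w + j * K + i < w + suc j * K
  block-end w j {i} i<K = begin-strict
    w + j * K + i      <⟨ +-monoʳ-< (w + j * K) i<K ⟩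
    w + j * K + K      ≡⟨ +-assoc w _ _ ⟩
    w + (j * K + K)    ≡⟨ cong (w +_) (+-comm (j * K) K) ⟩
    w + suc j * K      ∎
    where open ≤-Reasoning

  -- If all of the first m + 1 intervals met E, one element of E from each
  -- would give m + 1 elements in a window of length suc m * K.
  not-all-hit : ∀ {m N w} → Uncrowded E m (suc m * K) N → N ≤ w →
                ¬ (∀ (j : Fin (suc m)) → Hit w (toℕ j))
  not-all-hit {w = w} uncrowded N≤w hit = uncrowded w N≤w
    (λ j → w + toℕ j * K + offset j)
    (λ {j} j<j′ → <-≤-trans (end j) (≤-trans (+-monoʳ-≤ w (*-monoˡ-≤ K j<j′)) (m≤m+n _ _)))
    (λ j → ≤-trans (m≤m+n w _) (m≤m+n _ _))
    (λ j → <-≤-trans (end j) (+-monoʳ-≤ w (*-monoˡ-≤ K (toℕ<n j))))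
    (λ j → proj₂ (proj₂ (hit j)))
    where
    offset : _ → ℕ
    offset j = proj₁ (hit j)

    end : ∀ j → w + toℕ j * K + offset j < w + suc (toℕ j) * K
    end j = block-end w (toℕ j) (proj₁ (proj₂ (hit j)))

  -- The complement of a decidable member of 𝓛 contains K consecutive numbers
  -- from some s ≥ K on.  The search starts at N + K to ensure s ≥ K.
  𝓛-gap : E ∈ᴵ 𝓛 → ∃[ s ] K ≤ s × (∀ i → i < K → ¬ E (s + i))
  𝓛-gap E∈𝓛
    with m , uncrowded ← 𝓛-uncrowded E∈𝓛
    with N , unc ← uncrowded (suc m * K)
    with j , free ← ¬∀⟶∃¬ (suc m) (Hit (N + K) ∘ toℕ) (hit? (N + K) ∘ toℕ)
                      (not-all-hit unc (m≤m+n N K))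
    = N + K + toℕ j * K , ≤-trans (m≤n+m K N) (m≤m+n (N + K) _) ,
      λ i i<K e → free (i , i<K , e)

-- A set in 𝓛 whose preimage is not in 𝓛

-- For each K, run K provides the start of K consecutive numbers that f maps
-- to points of Clusters of level at least K.

module _ (f : ℕ → ℕ) (f∈ : ∀ x → Clusters (f x))
         (run : ∀ K → ∃[ s ] K ≤ s × (∀ i → i < K → ¬ Low K (f (s + i)))) where

  -- The f-image of the K-th run.
  InRun : ℕ → Pred ℕ 0ℓ
  InRun K y = ∃[ i ] i < K × f (proj₁ (run K) + i) ≡ y

  -- The f-image of the union of all runs.
  Runs : Pred ℕ 0ℓ
  Runs y = ∃[ K ] InRun K y

  inRun-level : ∀ n {K y} → InRun K y → PointOf n y → K ≤ level n
  inRun-level n {K} (i , i<K , refl) p = ≮⇒≥ λ l<K → proj₂ (proj₂ (run K)) i i<K (n , l<K , p)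

  Runs⊆ : Runs ⊆ Clusters
  Runs⊆ (_ , i , _ , refl) = f∈ _

  -- An element y of the image of the K-th run has level at least K, hence
  -- K ≤ y, and only finitely many runs have to be searched.
  runs? : Decidable Runs
  runs? y = map′ (λ (K , _ , p) → K , p)
    (λ (K , p) → let (n , q) = Runs⊆ (K , p) in
       K , s≤s (≤-trans (inRun-level n p q) (≤-trans (level≤ n) (pointOf⇒≤ n q))) , p)
    (anyUpTo? (λ K → anyUpTo? (λ i → f (proj₁ (run K) + i) ≟ y) K) (suc y))

  runs-bound : ∀ d → ∃[ N ] ∀ {K y} → K < d → InRun K y → y < N
  runs-bound d = let N , below = bound-< runBound d in
    N , λ { {K} K<d (i , i<K , refl) →
      <-trans (proj₂ (bound-< (run-value K) K) i<K) (below K<d) }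
    where
    run-value : ℕ → ℕ → ℕ
    run-value K i = f (proj₁ (run K) + i)

    runBound : ℕ → ℕ
    runBound K = proj₁ (bound-< (run-value K) K)

  -- Beyond the finitely many values from the runs with K < d, all elements
  -- of Runs have level at least d.
  runs-sparse : ∀ d → ∃[ N ] Sparse d N Runs
  runs-sparse d with N , below ← runs-bound d = N , sep
    where
    sep : Sparse d N Runs
    sep {x} (K , p) Ry N≤x x<y with Runs⊆ (K , p) | Runs⊆ Ry
    ... | n , q | m , q′ = ≤-trans
      (+-monoʳ-≤ x (≤-trans (≮⇒≥ λ K<d → <⇒≱ (below K<d p) N≤x) (inRun-level n p q)))
      (points-apart n m q q′ x<y)

  runs-preimage∉𝓛 : (Runs ∘ f) ∈⁺ 𝓛
  runs-preimage∉𝓛 R∈𝓛 with k , N , noRun ← 𝓛-noRuns R∈𝓛 =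
    noRun (proj₁ (run (N + k))) (≤-trans (m≤m+n N k) (proj₁ (proj₂ (run (N + k)))))
      (λ i i<k → N + k , i , ≤-trans i<k (m≤n+m k N) , refl)

-- Failure of homogeneity

trace∈ : ∀ {X : Set} (I : Ideal X) {A} (A∈⁺ : A ∈⁺ I) {B} → B ∈ᴵ I → trace A B ∈ᴵ restrict I A A∈⁺
trace∈ I A∈⁺ {B} B∈I = B , B∈I , id , id

-- Membership proofs in ⟪ Clusters ⟫ are irrelevant, but a relevant one is
-- recovered by deciding membership.
clusters-member : (a : ⟪ Clusters ⟫) → Clusters (value a)
clusters-member record { value = x ; proof = [ p ] } = recompute (clusters? x) p

restriction-≰K : ¬ (restrict 𝓛 Clusters Clusters∉𝓛 ≤K 𝓛)
restriction-≰K (f , pull) = runs-preimage∉𝓛 g (clusters-member ∘ f) run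
    (pullback (sparse⇒𝓛 (runs? g (clusters-member ∘ f) run) (runs-sparse g (clusters-member ∘ f) run)))
  where
  g : ℕ → ℕ
  g = value ∘ f

  pullback : ∀ {B} → B ∈ᴵ 𝓛 → (B ∘ g) ∈ᴵ 𝓛
  pullback {B} B∈ = pull (trace Clusters B) (trace∈ 𝓛 Clusters∉𝓛 B∈)

  run : ∀ K → ∃[ s ] K ≤ s × (∀ i → i < K → ¬ Low K (g (s + i)))
  run K = 𝓛-gap (low? K ∘ g) K (pullback (low∈𝓛 K))

proposition10p3 : ¬ ≤K-Homogeneous 𝓛 × ¬ Homogeneous 𝓛
proposition10p3 =
  (λ hom → restriction-≰K (proj₁ (hom Clusters Clusters∉𝓛))) ,
  (λ hom → let (f , iso) = hom Clusters Clusters∉𝓛 in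
    restriction-≰K (Bijection.to f , λ B → Equivalence.from (iso B)))
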